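{- Let $n$ be a positive integer divisible by $4$. Let $\mathcal{T}^*_n$ be the family of triangles on an $n$-element vertex set obtained as follows: choose $\frac{n}{4}$ pairwise disjoint pairs $\{u_i,w_i\}$ of vertices, let $R$ be the set of the remaining $\frac{n}{2}$ vertices, and let $\mathcal{T}^*_n=\{\{u_i,w_i,r\} : 1\le i\le \frac n4,\ r\in R\}$. Then $\mathcal{T}^*_n$ is a set of $\frac{n^2}{8}$ triangles with no rainbow triangle, and it is the unique such set up to isomorphism: every set of exactly $\frac{n^2}{8}$ distinct triangles on an $n$-element vertex set having no rainbow triangle is isomorphic to $\mathcal{T}^*_n$ (i.e., is the image of $\mathcal{T}^*_n$ under a bijection of the vertex sets).
   Context: A triangle on a vertex set $V$ is a $3$-element subset $\{x,y,z\}\subseteq V$, identified with its edge set $\{\{x,y\},\{y,z\},\{x,z\}\}$. For a family $\mathcal{T}$ of triangles, a rainbow triangle is a triangle $\{x,y,z\}$ on $V$ together with three distinct members $t_1,t_2,t_3$ of $\mathcal{T}$ such that $\{x,y\}$ is an edge of $t_1$, $\{y,z\}$ is an edge of $t_2$ and $\{x,z\}$ is an edge of $t_3$. -}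

module Defs where

open import Data.Fin using (Fin; zero; suc; inject≤; combine)
open import Data.Fin.Permutation using (Permutation′; _⟨$⟩ˡ_)
open import Data.Fin.Properties using (inject≤-injective; combine-injectiveˡ; combine-injectiveʳ)
open import Data.Fin.Subset using (Subset; _∈_; _∪_; _∩_; ∁; ⋃; ⁅_⁆; ∣_∣; Empty)
open import Data.Fin.Subset.Properties using (_∈?_; x∈p∩q⁻; x∈p∪q⁻; x∈⁅y⁆⇒x≡y)
open import Data.List using (List; length; map; filter; allFin; cartesianProductWith)
open import Data.List.Membership.Propositional using () renaming (_∈_ to _∈ₗ_)
open import Data.List.Relation.Binary.BagAndSetEquality using (_∼[_]_; set)
open import Data.List.Relation.Unary.All using (All)
open import Data.List.Relation.Unary.Unique.Propositional using (Unique)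
open import Data.Nat using (ℕ; _*_; _≤_; _/_; z≤n; s≤s)
open import Data.Nat.DivMod using (m/n*n≤m)
open import Data.Nat.Properties using (≤-trans; *-monoʳ-≤)
open import Data.Product using (_×_; _,_; ∃; ∃-syntax)
open import Data.Sum using (inj₁; inj₂)
open import Data.Vec using (tabulate; lookup)
open import Relation.Binary.PropositionalEquality using (_≡_; _≢_; refl; sym; trans)

IsTriangle : ∀ {n} → Subset n → Set
IsTriangle t = ∣ t ∣ ≡ 3

-- A set of triangles is listed without repetition, in an arbitrary order,
-- so its cardinality is the length of the list.
record IsTriangleSet {n} (m : ℕ) (T : List (Subset n)) : Set where
  field
    triangles : All IsTriangle T
    distinct  : Unique T
    size      : length T ≡ m

HasEdge : ∀ {n} → Subset n → Fin n → Fin n → Set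
HasEdge t x y = x ≢ y × x ∈ t × y ∈ t

-- x, y and z are pairwise distinct because HasEdge requires distinct ends.
record RainbowTriangle {n} (T : List (Subset n)) : Set where
  field
    x y z    : Fin n
    t₁ t₂ t₃ : Subset n
    t₁∈T     : t₁ ∈ₗ T
    t₂∈T     : t₂ ∈ₗ T
    t₃∈T     : t₃ ∈ₗ T
    t₁≢t₂    : t₁ ≢ t₂
    t₂≢t₃    : t₂ ≢ t₃
    t₁≢t₃    : t₁ ≢ t₃
    xy∈t₁    : HasEdge t₁ x y
    yz∈t₂    : HasEdge t₂ y z
    xz∈t₃    : HasEdge t₃ x z

record Pairing (n : ℕ) : Set where
  field
    u w : Fin (n / 4) → Fin n

  pair : Fin (n / 4) → Subset n
  pair i = ⁅ u i ⁆ ∪ ⁅ w i ⁆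

  field
    u≢w      : ∀ i → u i ≢ w i
    disjoint : ∀ {i j} → i ≢ j → Empty (pair i ∩ pair j)

  R : Subset n
  R = ∁ (⋃ (map pair (allFin (n / 4))))

T* : ∀ {n} → Pairing n → List (Subset n)
T* {n} P = cartesianProductWith (λ i r → ⁅ u i ⁆ ∪ ⁅ w i ⁆ ∪ ⁅ r ⁆)
                                (allFin (n / 4)) (filter (_∈? R) (allFin n))
  where open Pairing P

-- The vertex v lies in the image of t exactly when φ⁻¹ v lies in t.
image : ∀ {n} → Permutation′ n → Subset n → Subset n
image φ t = tabulate (λ v → lookup t (φ ⟨$⟩ˡ v))

-- Equality of the two families is as sets: the order of listing is ignored.
_IsIsomorphicTo_ : ∀ {n} → List (Subset n) → List (Subset n) → Set
_IsIsomorphicTo_ {n} T T′ = ∃[ φ ] T ∼[ set ] map (image {n} φ) T′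

-- Pairings exist, so statements about every pairing are not vacuous.
pairing : ∀ n → Pairing n
pairing n = record
  { u = λ i → vertex i zero
  ; w = λ i → vertex i (suc zero)
  ; u≢w = λ i e → 0≢1 (combine-injectiveʳ i zero i (suc zero) (inject≤-injective bound bound _ _ e))
  ; disjoint = λ i≢j (v , v∈) → let a , b = x∈p∩q⁻ _ _ v∈ in i≢j (same (ends a) (ends b))
  }
  where
  bound : (n / 4) * 2 ≤ n
  bound = ≤-trans (*-monoʳ-≤ (n / 4) (s≤s (s≤s z≤n))) (m/n*n≤m n 4)

  vertex : Fin (n / 4) → Fin 2 → Fin n
  vertex i b = inject≤ (combine i b) bound

  0≢1 : zero {1} ≢ suc zero
  0≢1 ()

  ends : ∀ {v i} → v ∈ ⁅ vertex i zero ⁆ ∪ ⁅ vertex i (suc zero) ⁆ → ∃ λ b → v ≡ vertex i b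
  ends v∈ with x∈p∪q⁻ _ _ v∈
  ... | inj₁ v∈u = zero , x∈⁅y⁆⇒x≡y _ v∈u
  ... | inj₂ v∈w = suc zero , x∈⁅y⁆⇒x≡y _ v∈w

  same : ∀ {v i j} → (∃ λ b → v ≡ vertex i b) → (∃ λ b → v ≡ vertex j b) → i ≡ j
  same {i = i} {j} (b , p) (c , q) =
    combine-injectiveˡ i b j c (inject≤-injective bound bound _ _ (trans (sym p) q))

{-# OPTIONS --safe #-}
-- If two edges of a triangle of T each lay in a further triangle of T, those
-- two triangles and the triangle itself would be rainbow. So every triangle has
-- two edges lying in no other triangle of T; keep two such edges, a cherry. The
-- kept edges form a triangle-free graph with 2|T| = n²/4 edges, which by the
-- equality case of Mantel's theorem is complete bipartite and balanced. For a
-- cherry with leaves a, b and any d on the side of its centre, {a,b,d} must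
-- belong to T, since the triangles containing da and db would otherwise be
-- rainbow with the triangle of the cherry. It follows that all centres lie on
-- one side, and that the leaves pair off the other side.
module Submission where

open import Defs
open import Data.Bool using (Bool; true; false; not; _xor_)
open import Data.Bool.Properties as Bool using (xor-same; ¬-not)
open import Data.Empty using (⊥; ⊥-elim)
open import Data.Fin using (Fin; zero; suc; _≟_)
open import Data.Fin.Patterns using (0F; 1F)
open import Data.Fin.Permutation using (Permutation′; _⟨$⟩ʳ_; _⟨$⟩ˡ_; inverseˡ; inverseʳ; ↔⇒≡)
open import Data.Fin.Properties as Fin using (+↔⊎; *↔×; any?)
open import Data.Fin.Subset using (Subset; _∈_; _∉_; _⊆_; _∪_; ⋃; ⁅_⁆; ∣_∣; inside; outside)
  renaming (⊥ to ∅)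
open import Data.Fin.Subset.Properties
  using (x∈⁅x⁆; x∈⁅y⁆⇒x≡y; x≢y⇒x∉⁅y⁆; ∣⁅x⁆∣≡1; x∈p∪q⁺; x∈p∪q⁻; x∈p∩q⁺; ∪-identityˡ; ∪-identityʳ;
         ⊆-antisym; p⊂q⇒∣p∣<∣q∣; ∉⊥; x∈∁p⇒x∉p; x∉p⇒x∈∁p; _∈?_)
open import Data.List as List using (List; []; _∷_; length; map; filter; allFin; cartesianProductWith)
import Data.List.Extrema
open import Data.List.Membership.Propositional using () renaming (_∈_ to _∈ₗ_)
open import Data.List.Membership.Propositional.Properties
  using (∈-allFin; ∈-lookup; ∈-map⁺; ∈-map⁻; ∈-filter⁺; ∈-filter⁻; ∈-cartesianProductWith⁺; ∈-cartesianProductWith⁻)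
import Data.List.Properties as List
import Data.List.Relation.Unary.All as All
open import Data.List.Relation.Unary.AllPairs using (_∷_)
open import Data.List.Relation.Unary.Any as Any using (here; there)
open import Data.List.Relation.Unary.Any.Properties using (lookup-index)
open import Data.List.Relation.Unary.Unique.Propositional using (Unique)
import Data.List.Relation.Unary.Unique.Propositional.Properties as Unique
open import Data.Nat using (ℕ; zero; suc; NonZero; ≢-nonZero⁻¹; _+_; _*_; _^_; _/_; _≤_; z≤n; s≤s)
open import Data.Nat.Divisibility using (_∣_)
open import Data.Nat.DivMod using (m*n/n≡m; m/n*n≡m)
open import Data.Nat.Properties hiding (_≟_)
open import Data.Nat.Solver using (module +-*-Solver)
open import Data.Product using (_×_; _,_; ∃-syntax; proj₁; proj₂)
open import Data.Product.Function.NonDependent.Propositional using (_×-↔_)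
open import Data.Product.Properties using (≡-dec; ,-injective)
open import Data.Sum using (_⊎_; inj₁; inj₂; [_,_]′; reduce)
open import Data.Sum.Function.Propositional using (_⊎-↔_)
open import Data.Vec using ([]; _∷_; here; there)
open import Data.Vec.Properties using (lookup∘tabulate; []=⇒lookup; lookup⇒[]=)
open import Function using (_∘_; id; _↔_; mk↔ₛ′; mk⇔; Inverse; Injection)
open import Function.Construct.Composition using (_↔-∘_)
open import Function.Construct.Identity using (↔-id)
open import Function.Construct.Symmetry using (↔-sym)
open import Function.Properties.Inverse using (↔⇒↣)
open import Level using (0ℓ)
open import Relation.Binary.PropositionalEquality
open import Relation.Nullary using (¬_; Dec; yes; no; does; contradiction)
open import Relation.Nullary.Decidable using (dec-true; dec-false; decidable-stable; ¬?; _×-dec_; _⊎-dec_)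
open import Relation.Unary using (Pred; Decidable)

open import Algebra.Properties.Semiring.Sum +-*-semiring
  using (sum; sum-syntax; sum-cong-≗; ∑-comm; ∑-distrib-+; *-distribˡ-sum)
open Data.List.Extrema ≤-totalOrder using (argmax; f[xs]≤f[argmax])

-- Sums of indicators and two squeezing arguments.

𝟙 : Bool → ℕ
𝟙 false = 0
𝟙 true  = 1

𝟙-injective : ∀ {a b} → 𝟙 a ≡ 𝟙 b → a ≡ b
𝟙-injective {false} {false} _ = refl
𝟙-injective {true}  {true}  _ = refl

𝟙-mono : ∀ {a b} → (a ≡ true → b ≡ true) → 𝟙 a ≤ 𝟙 b
𝟙-mono {false}        _   = z≤n
𝟙-mono {true} {true}  _   = ≤-refl
𝟙-mono {true} {false} a⇒b with () ← a⇒b refl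

sum-mono : ∀ {n} {f g : Fin n → ℕ} → (∀ i → f i ≤ g i) → sum f ≤ sum g
sum-mono {zero}  f≤g = z≤n
sum-mono {suc n} f≤g = +-mono-≤ (f≤g zero) (sum-mono (f≤g ∘ suc))

term≤sum : ∀ {n} (f : Fin n → ℕ) i → f i ≤ sum f
term≤sum f zero    = m≤m+n _ _
term≤sum f (suc i) = ≤-trans (term≤sum (f ∘ suc) i) (m≤n+m _ (f zero))

+-squeeze : ∀ {a b c d} → a ≤ c → b ≤ d → c + d ≤ a + b → a ≡ c × b ≡ d
+-squeeze {a} {b} {c} {d} a≤c b≤d c+d≤a+b =
  ≤-antisym a≤c (+-cancelʳ-≤ b c a (≤-trans (+-monoʳ-≤ c b≤d) c+d≤a+b)) ,
  ≤-antisym b≤d (+-cancelˡ-≤ a d b (≤-trans (+-monoˡ-≤ d a≤c) c+d≤a+b))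

-- There is no slack in a total that could hide slack in a single term. This extracts the equality
-- case from each inequality of the Mantel count.
sum-squeeze : ∀ {n} {f g : Fin n → ℕ} → (∀ i → f i ≤ g i) → sum g ≤ sum f → ∀ i → f i ≡ g i
sum-squeeze f≤g g≤f zero =
  proj₁ (+-squeeze (f≤g zero) (sum-mono (f≤g ∘ suc)) g≤f)
sum-squeeze f≤g g≤f (suc i) =
  sum-squeeze (f≤g ∘ suc) (≤-reflexive (sym (proj₂ (+-squeeze (f≤g zero) (sum-mono (f≤g ∘ suc)) g≤f)))) i

sum-one : ∀ n → ∑[ i < n ] 1 ≡ n
sum-one zero    = refl
sum-one (suc n) = cong suc (sum-one n)

sum-complement : ∀ {n} (s : Fin n → Bool) → ∑[ i < n ] 𝟙 (s i) + ∑[ i < n ] 𝟙 (not (s i)) ≡ n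
sum-complement {n} s = trans (sym (∑-distrib-+ (𝟙 ∘ s) (𝟙 ∘ not ∘ s))) (trans (sum-cong-≗ (one ∘ s)) (sum-one n))
  where
  one : ∀ b → 𝟙 b + 𝟙 (not b) ≡ 1
  one false = refl
  one true  = refl

maximum : ∀ {n} → Fin n → (f : Fin n → ℕ) → ∃[ v ] ∀ x → f x ≤ f v
maximum {n} x₀ f = argmax f x₀ (allFin n) ,
  λ x → All.lookup (f[xs]≤f[argmax] {f = f} x₀ (allFin n)) (∈-allFin x)

-- The difference of the two sides is the square of p - q. To stay in the naturals, the larger
-- number is written as the smaller plus d, and d * d ≤ 0 remains.
square≤4*product⇒≡ : ∀ p q → (p + q) * (p + q) ≤ 4 * (p * q) → p ≡ q
square≤4*product⇒≡ p q h = split (≤-total p q)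
  where
  open +-*-Solver

  ordered : ∀ {p q} → p ≤ q → (p + q) * (p + q) ≤ 4 * (p * q) → p ≡ q
  ordered {p} p≤q h with m≤n⇒∃[o]m+o≡n p≤q
  ... | d , refl = sym (trans (cong (p +_) d≡0) (+-identityʳ p))
    where
    expand : (p + (p + d)) * (p + (p + d)) ≡ 4 * (p * (p + d)) + d * d
    expand = solve 2 (λ p d → (p :+ (p :+ d)) :* (p :+ (p :+ d)) := con 4 :* (p :* (p :+ d)) :+ d :* d) refl p d
    d²≤0 : d * d ≤ 0
    d²≤0 = +-cancelˡ-≤ (4 * (p * (p + d))) (d * d) 0
      (≤-trans (≤-reflexive (sym expand)) (≤-trans h (≤-reflexive (sym (+-identityʳ _)))))
    d≡0 : d ≡ 0
    d≡0 = reduce (m*n≡0⇒m≡0∨n≡0 d (n≤0⇒n≡0 d²≤0))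

  split : p ≤ q ⊎ q ≤ p → p ≡ q
  split (inj₁ p≤q) = ordered p≤q h
  split (inj₂ q≤p) = sym (ordered q≤p (subst₂ _≤_ (cong₂ _*_ (+-comm p q) (+-comm p q)) (cong (4 *_) (*-comm p q)) h))

-- The equality case of Mantel's theorem.

module Mantel {n} (E : Fin n → Fin n → Bool)
  (E-sym : ∀ x y → E x y ≡ E y x)
  (triangle-free : ∀ x y z → E x y ≡ true → E y z ≡ true → E x z ≡ true → ⊥)
  where

  degree : Fin n → ℕ
  degree x = ∑[ y < n ] 𝟙 (E x y)

  -- The degree sum counts every edge twice, so `dense` says that there are at least n²/4 edges.
  module _ (v : Fin n) (degree≤ : ∀ x → degree x ≤ degree v)
           (dense : n * n ≤ 2 * ∑[ x < n ] degree x) where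

    far : Fin n → ℕ
    far x = 𝟙 (not (E v x))

    farCount : ℕ
    farCount = ∑[ x < n ] far x

    -- The neighbourhood of v is independent, so every edge has an end outside it.
    edge≤ : ∀ x y → 𝟙 (E x y) ≤ far x * 𝟙 (E x y) + far y * 𝟙 (E x y)
    edge≤ x y with E v x in vx | E v y in vy
    ... | false | _     = ≤-trans (m≤m+n _ 0) (m≤m+n _ _)
    ... | true  | false = m≤m+n _ 0
    ... | true  | true  = 𝟙-mono (λ xy → ⊥-elim (triangle-free v x y vx xy vy))

    rows : ∀ x → ∑[ y < n ] (far x * 𝟙 (E x y) + far y * 𝟙 (E x y)) ≡
                 far x * degree x + ∑[ y < n ] (far y * 𝟙 (E x y))
    rows x = trans (∑-distrib-+ (λ y → far x * 𝟙 (E x y)) (λ y → far y * 𝟙 (E x y)))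
      (cong (_+ ∑[ y < n ] (far y * 𝟙 (E x y))) (sym (*-distribˡ-sum (far x) (λ y → 𝟙 (E x y)))))

    farDegrees : ℕ
    farDegrees = ∑[ x < n ] (far x * degree x)

    columns : ∑[ x < n ] ∑[ y < n ] (far y * 𝟙 (E x y)) ≡ farDegrees
    columns = trans (∑-comm (λ x y → far y * 𝟙 (E x y))) (sum-cong-≗ (λ y →
      trans (sym (*-distribˡ-sum (far y) (λ x → 𝟙 (E x y)))) (cong (far y *_) (sum-cong-≗ (λ x → cong 𝟙 (E-sym x y))))))

    -- The two summands contribute equally: one is summed along rows, the other along columns, and
    -- `E` is symmetric.
    total : ∑[ x < n ] ∑[ y < n ] (far x * 𝟙 (E x y) + far y * 𝟙 (E x y)) ≡ 2 * farDegrees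
    total = trans (sum-cong-≗ rows) (trans (∑-distrib-+ (λ x → far x * degree x) (λ x → ∑[ y < n ] (far y * 𝟙 (E x y))))
      (cong (farDegrees +_) (trans columns (sym (+-identityʳ _)))))

    degrees≤ : ∑[ x < n ] degree x ≤ 2 * farDegrees
    degrees≤ = ≤-trans (sum-mono (λ x → sum-mono (edge≤ x))) (≤-reflexive total)

    farDegree≤ : ∀ x → far x * degree x ≤ far x * degree v
    farDegree≤ x = *-monoʳ-≤ (far x) (degree≤ x)

    bound : ∑[ x < n ] (far x * degree v) ≡ degree v * farCount
    bound = trans (sum-cong-≗ (λ x → *-comm (far x) (degree v))) (sym (*-distribˡ-sum (degree v) far))

    farDegrees≤ : farDegrees ≤ degree v * farCount
    farDegrees≤ = ≤-trans (sum-mono farDegree≤) (≤-reflexive bound)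

    degree+farCount : degree v + farCount ≡ n
    degree+farCount = sum-complement (E v)

    n²≤4*farDegrees : n * n ≤ 4 * farDegrees
    n²≤4*farDegrees = ≤-trans dense (≤-trans (*-monoʳ-≤ 2 degrees≤) (≤-reflexive (sym (*-assoc 2 2 farDegrees))))

    -- Density and maximality of `degree v` give n² ≤ 4 * `farDegrees` ≤ 4 * `degree v` *
    -- `farCount`, while the last two factors add up to n. Only equal factors allow this.
    balanced : degree v ≡ farCount
    balanced = square≤4*product⇒≡ _ _ (subst (λ N → N * N ≤ 4 * (degree v * farCount)) (sym degree+farCount)
      (≤-trans n²≤4*farDegrees (*-monoʳ-≤ 4 farDegrees≤)))

    4*product≡n² : 4 * (degree v * farCount) ≡ n * n
    4*product≡n² = trans (subst (λ q → 4 * (degree v * q) ≡ (degree v + q) * (degree v + q)) balanced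
      (solve 1 (λ p → con 4 :* (p :* p) := (p :+ p) :* (p :+ p)) refl (degree v)))
      (cong₂ _*_ degree+farCount degree+farCount)
      where open +-*-Solver

    -- Balance makes both ends of the chain of estimates equal to n², so every link can be reversed.
    -- This one and `farDegrees≥` are the links to be squeezed term by term.
    degrees≥ : 2 * farDegrees ≤ ∑[ x < n ] degree x
    degrees≥ = *-cancelˡ-≤ 2 (begin
      2 * (2 * farDegrees)         ≡⟨ *-assoc 2 2 farDegrees ⟨
      4 * farDegrees               ≤⟨ *-monoʳ-≤ 4 farDegrees≤ ⟩
      4 * (degree v * farCount)    ≡⟨ 4*product≡n² ⟩
      n * n                        ≤⟨ dense ⟩
      2 * ∑[ x < n ] degree x      ∎)
      where open ≤-Reasoning

    farDegrees≥ : degree v * farCount ≤ farDegrees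
    farDegrees≥ = *-cancelˡ-≤ 4 (≤-trans (≤-reflexive 4*product≡n²) n²≤4*farDegrees)

    edge≡ : ∀ x y → 𝟙 (E x y) ≡ far x * 𝟙 (E x y) + far y * 𝟙 (E x y)
    edge≡ x = sum-squeeze (edge≤ x) (≤-reflexive (sym
      (sum-squeeze (λ x → sum-mono (edge≤ x)) (≤-trans (≤-reflexive total) degrees≥) x)))

    farDegree≡ : ∀ x → far x * degree x ≡ far x * degree v
    farDegree≡ = sum-squeeze farDegree≤ (≤-trans (≤-reflexive bound) farDegrees≥)

    -- A far `x` has no far neighbour, so its neighbourhood lies inside that of `v`. Tightness also
    -- gives it the degree of `v`, so the neighbourhoods agree.
    full : ∀ x → E v x ≡ false → ∀ y → E x y ≡ E v y
    full x vx y = 𝟙-injective (sum-squeeze (λ y → 𝟙-mono (adjacent⇒near y)) (≤-reflexive (sym degree≡)) y)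
      where
      degree≡ : degree x ≡ degree v
      degree≡ with p ← farDegree≡ x rewrite vx = trans (sym (+-identityʳ _)) (trans p (+-identityʳ _))

      adjacent⇒near : ∀ y → E x y ≡ true → E v y ≡ true
      adjacent⇒near y xy with p ← edge≡ x y rewrite vx | xy with E v y
      ... | true  = refl
      -- An edge with both ends far would be counted twice on the right of `edge≡`.
      ... | false with () ← p

    -- The colouring is adjacency to `v`. A far end is handled by `full`, and two near ends cannot
    -- be adjacent without forming a triangle with `v`.
    bipartite : ∀ x y → E x y ≡ E v x xor E v y
    bipartite x y with E v x in vx
    ... | false = full x vx y
    ... | true with E v y in vy
    ...   | false = trans (E-sym x y) (trans (full y vy x) vx)
    ...   | true  = ¬-not (λ xy → triangle-free v x y vx xy vy)

  completeBipartite : Fin n → n * n ≤ 2 * ∑[ x < n ] degree x →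
    ∃[ s ] (∀ x y → E x y ≡ s x xor s y) × ∑[ x < n ] 𝟙 (s x) ≡ ∑[ x < n ] 𝟙 (not (s x))
  completeBipartite x₀ dense with maximum x₀ degree
  ... | v , degree≤ = E v , bipartite v degree≤ dense , balanced v degree≤ dense

-- Triangles as three-element subsets, and their images under permutations.

private variable
  n k l : ℕ

triangle : Fin n → Fin n → Fin n → Subset n
triangle x y z = ⁅ x ⁆ ∪ ⁅ y ⁆ ∪ ⁅ z ⁆

∈-triangle⁻ : ∀ {v x y z : Fin n} → v ∈ triangle x y z → v ≡ x ⊎ v ≡ y ⊎ v ≡ z
∈-triangle⁻ {x = x} {y} {z} v∈ with x∈p∪q⁻ ⁅ x ⁆ _ v∈
... | inj₁ v∈x = inj₁ (x∈⁅y⁆⇒x≡y x v∈x)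
... | inj₂ v∈yz with x∈p∪q⁻ ⁅ y ⁆ _ v∈yz
...   | inj₁ v∈y = inj₂ (inj₁ (x∈⁅y⁆⇒x≡y y v∈y))
...   | inj₂ v∈z = inj₂ (inj₂ (x∈⁅y⁆⇒x≡y z v∈z))

∈-triangle₁ : ∀ (x y z : Fin n) → x ∈ triangle x y z
∈-triangle₁ x y z = x∈p∪q⁺ (inj₁ (x∈⁅x⁆ x))

∈-triangle₂ : ∀ (x y z : Fin n) → y ∈ triangle x y z
∈-triangle₂ x y z = x∈p∪q⁺ (inj₂ (x∈p∪q⁺ (inj₁ (x∈⁅x⁆ y))))

∈-triangle₃ : ∀ (x y z : Fin n) → z ∈ triangle x y z
∈-triangle₃ x y z = x∈p∪q⁺ (inj₂ (x∈p∪q⁺ (inj₂ (x∈⁅x⁆ z))))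

triangle-⊆ : ∀ {x y z : Fin n} {p} → x ∈ p → y ∈ p → z ∈ p → triangle x y z ⊆ p
triangle-⊆ x∈p y∈p z∈p v∈ with ∈-triangle⁻ v∈
... | inj₁ refl        = x∈p
... | inj₂ (inj₁ refl) = y∈p
... | inj₂ (inj₂ refl) = z∈p

∣⁅x⁆∪p∣ : ∀ {x : Fin n} {p} → x ∉ p → ∣ ⁅ x ⁆ ∪ p ∣ ≡ suc ∣ p ∣
∣⁅x⁆∪p∣ {x = zero}  {inside  ∷ p} x∉p = contradiction here x∉p
∣⁅x⁆∪p∣ {x = zero}  {outside ∷ p} x∉p = cong (suc ∘ ∣_∣) (∪-identityˡ p)
∣⁅x⁆∪p∣ {x = suc x} {inside  ∷ p} x∉p = cong suc (∣⁅x⁆∪p∣ (x∉p ∘ there))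
∣⁅x⁆∪p∣ {x = suc x} {outside ∷ p} x∉p = ∣⁅x⁆∪p∣ (x∉p ∘ there)

∣triangle∣ : ∀ {x y z : Fin n} → x ≢ y → x ≢ z → y ≢ z → ∣ triangle x y z ∣ ≡ 3
∣triangle∣ {x = x} {y} {z} x≢y x≢z y≢z =
  trans (∣⁅x⁆∪p∣ x∉) (cong suc (trans (∣⁅x⁆∪p∣ (x≢y⇒x∉⁅y⁆ y≢z)) (cong suc (∣⁅x⁆∣≡1 z))))
  where
  x∉ : x ∉ ⁅ y ⁆ ∪ ⁅ z ⁆
  x∉ = [ x≢y⇒x∉⁅y⁆ x≢y , x≢y⇒x∉⁅y⁆ x≢z ]′ ∘ x∈p∪q⁻ _ _

∣p∣≡0⇒p≡∅ : ∀ {p : Subset n} → ∣ p ∣ ≡ 0 → p ≡ ∅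
∣p∣≡0⇒p≡∅ {p = []}          _ = refl
∣p∣≡0⇒p≡∅ {p = outside ∷ p} e = cong (outside ∷_) (∣p∣≡0⇒p≡∅ e)

remove-element : ∀ {p : Subset n} → ∣ p ∣ ≡ suc k → ∃[ x ] ∃[ q ] p ≡ ⁅ x ⁆ ∪ q × x ∉ q × ∣ q ∣ ≡ k
remove-element {p = inside ∷ p} e =
  zero , outside ∷ p , cong (inside ∷_) (sym (∪-identityˡ p)) , (λ ()) , suc-injective e
remove-element {p = outside ∷ p} e with remove-element {p = p} e
... | x , q , refl , x∉q , e′ = suc x , outside ∷ q , refl , (λ { (there x∈q) → x∉q x∈q }) , e′

isTriangle⇒triangle : ∀ {p : Subset n} → IsTriangle p →
  ∃[ x ] ∃[ y ] ∃[ z ] x ≢ y × x ≢ z × y ≢ z × p ≡ triangle x y z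
isTriangle⇒triangle {p = p} e with remove-element {p = p} e
... | x , q₂ , refl , x∉ , e₂ with remove-element {p = q₂} e₂
... | y , q₁ , refl , y∉ , e₁ with remove-element {p = q₁} e₁
... | z , q , refl , z∉ , e₀ =
  x , y , z , (λ { refl → x∉ (x∈p∪q⁺ (inj₁ (x∈⁅x⁆ x))) }) ,
  (λ { refl → x∉ (x∈p∪q⁺ (inj₂ (x∈p∪q⁺ (inj₁ (x∈⁅x⁆ x))))) }) ,
  (λ { refl → y∉ (x∈p∪q⁺ (inj₁ (x∈⁅x⁆ y))) }) ,
  cong (λ q → ⁅ x ⁆ ∪ ⁅ y ⁆ ∪ q) (trans (cong (⁅ z ⁆ ∪_) (∣p∣≡0⇒p≡∅ e₀)) (∪-identityʳ ⁅ z ⁆))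

⊆∧∣∣≡⇒≡ : ∀ {p q : Subset n} → p ⊆ q → ∣ p ∣ ≡ ∣ q ∣ → p ≡ q
⊆∧∣∣≡⇒≡ {p = p} {q} p⊆q e = ⊆-antisym p⊆q q⊆p
  where
  q⊆p : q ⊆ p
  q⊆p {x} x∈q with x ∈? p
  ... | yes x∈p = x∈p
  ... | no  x∉p = contradiction (p⊂q⇒∣p∣<∣q∣ (p⊆q , x , x∈q , x∉p)) (<-irrefl e)

∈-image : ∀ (φ : Permutation′ n) {t v} → φ ⟨$⟩ˡ v ∈ t → v ∈ image φ t
∈-image φ {t} {v} v∈ = lookup⇒[]= v _ (trans (lookup∘tabulate _ v) ([]=⇒lookup v∈))

∈-image⁻ : ∀ (φ : Permutation′ n) {t v} → v ∈ image φ t → φ ⟨$⟩ˡ v ∈ t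
∈-image⁻ φ {t} {v} v∈ = lookup⇒[]= _ t (trans (sym (lookup∘tabulate _ v)) ([]=⇒lookup v∈))

image-triangle : ∀ (φ : Permutation′ n) x y z →
  image φ (triangle x y z) ≡ triangle (φ ⟨$⟩ʳ x) (φ ⟨$⟩ʳ y) (φ ⟨$⟩ʳ z)
image-triangle φ x y z = ⊆-antisym forth
  (triangle-⊆ (back (∈-triangle₁ x y z)) (back (∈-triangle₂ x y z)) (back (∈-triangle₃ x y z)))
  where
  back : ∀ {v} → v ∈ triangle x y z → φ ⟨$⟩ʳ v ∈ image φ (triangle x y z)
  back v∈ = ∈-image φ (subst (_∈ triangle x y z) (sym (inverseˡ φ)) v∈)

  moved : ∀ {v w} → φ ⟨$⟩ˡ v ≡ w → v ≡ φ ⟨$⟩ʳ w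
  moved refl = sym (inverseʳ φ)

  forth : image φ (triangle x y z) ⊆ triangle (φ ⟨$⟩ʳ x) (φ ⟨$⟩ʳ y) (φ ⟨$⟩ʳ z)
  forth v∈ with ∈-triangle⁻ (∈-image⁻ φ v∈)
  ... | inj₁ e        rewrite moved e = ∈-triangle₁ _ _ _
  ... | inj₂ (inj₁ e) rewrite moved e = ∈-triangle₂ (φ ⟨$⟩ʳ x) _ _
  ... | inj₂ (inj₂ e) rewrite moved e = ∈-triangle₃ (φ ⟨$⟩ʳ x) (φ ⟨$⟩ʳ y) _

-- Families of blocks, each made of one pair and one single vertex.

-- Fin k × Fin 2 labels the ends of k disjoint pairs, Fin l the vertices outside them.
Labelling : ℕ → ℕ → ℕ → Set
Labelling k l n = (Fin k × Fin 2 ⊎ Fin l) ↔ Fin n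

-- This replaces counting subsets: once one of `k` and `l` is known, the other follows.
labelling-size : Labelling k l n → k * 2 + l ≡ n
labelling-size S = ↔⇒≡ (S ↔-∘ ((*↔× ⊎-↔ ↔-id _) ↔-∘ +↔⊎))

injective∧surjective⇒↔ : ∀ {A : Set} {f : A → Fin n} → (∀ a b → f a ≡ f b → a ≡ b) →
  (∀ y → ∃[ a ] f a ≡ y) → A ↔ Fin n
injective∧surjective⇒↔ {f = f} inj surj = mk↔ₛ′ f (proj₁ ∘ surj) (proj₂ ∘ surj)
  (λ a → inj _ a (proj₂ (surj (f a))))

module Blocks {k l n} (S : Labelling k l n) where
  open Inverse S using (to; from; strictlyInverseˡ)

  end : Fin k → Fin 2 → Fin n
  end i s = to (inj₁ (i , s))

  single : Fin l → Fin n
  single r = to (inj₂ r)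

  block : Fin k → Fin l → Subset n
  block i r = triangle (end i 0F) (end i 1F) (single r)

  -- Membership in a block, read off the label. It becomes an equation between indices, which
  -- matching on `refl` can solve.
  Lies : Fin k → Fin l → Fin k × Fin 2 ⊎ Fin l → Set
  Lies i r (inj₁ (j , _)) = j ≡ i
  Lies i r (inj₂ q)       = q ≡ r

  open Injection (↔⇒↣ S) using () renaming (injective to to-injective)

  ∈-block⁻ : ∀ {i r} a → to a ∈ block i r → Lies i r a
  ∈-block⁻ {i} {r} a a∈ with ∈-triangle⁻ a∈
  ... | inj₁ e        rewrite to-injective e = refl
  ... | inj₂ (inj₁ e) rewrite to-injective e = refl
  ... | inj₂ (inj₂ e) rewrite to-injective e = refl

  block-isTriangle : ∀ i r → IsTriangle (block i r)
  block-isTriangle i r = ∣triangle∣ (λ e → contradiction (to-injective e) λ ())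
    (λ e → contradiction (to-injective e) λ ()) (λ e → contradiction (to-injective e) λ ())

  block-injective : ∀ {i j q r} → block i q ≡ block j r → i ≡ j × q ≡ r
  block-injective {i} {j} {q} {r} e =
    ∈-block⁻ (inj₁ (i , 0F)) (subst (end i 0F ∈_) e (∈-triangle₁ _ _ _)) ,
    ∈-block⁻ (inj₂ q) (subst (single q ∈_) e (∈-triangle₃ (end i 0F) (end i 1F) _))

  -- Two singles in a common block coincide, and three ends would all belong to one pair, which has
  -- only two. So exactly one label is a single. The other two are the ends of one pair, and the two
  -- blocks through the single share both pair and single.
  noRainbow : ∀ a b c {i₁ i₂ i₃ r₁ r₂ r₃} → a ≢ b → b ≢ c → a ≢ c →
    Lies i₁ r₁ a → Lies i₁ r₁ b → Lies i₂ r₂ b → Lies i₂ r₂ c → Lies i₃ r₃ a → Lies i₃ r₃ c →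
    (i₁ ≡ i₂ × r₁ ≡ r₂) ⊎ (i₂ ≡ i₃ × r₂ ≡ r₃) ⊎ (i₁ ≡ i₃ × r₁ ≡ r₃)
  noRainbow (inj₁ (_ , 0F)) (inj₁ (_ , 0F)) _ a≢b b≢c a≢c refl refl _ _ _ _ = contradiction refl a≢b
  noRainbow (inj₁ (_ , 1F)) (inj₁ (_ , 1F)) _ a≢b b≢c a≢c refl refl _ _ _ _ = contradiction refl a≢b
  noRainbow (inj₁ (_ , 0F)) _ (inj₁ (_ , 0F)) a≢b b≢c a≢c _ _ _ _ refl refl = contradiction refl a≢c
  noRainbow (inj₁ (_ , 1F)) _ (inj₁ (_ , 1F)) a≢b b≢c a≢c _ _ _ _ refl refl = contradiction refl a≢c
  noRainbow _ (inj₁ (_ , 0F)) (inj₁ (_ , 0F)) a≢b b≢c a≢c _ _ refl refl _ _ = contradiction refl b≢c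
  noRainbow _ (inj₁ (_ , 1F)) (inj₁ (_ , 1F)) a≢b b≢c a≢c _ _ refl refl _ _ = contradiction refl b≢c
  noRainbow (inj₂ _) (inj₂ _) _ a≢b b≢c a≢c refl refl _ _ _ _ = contradiction refl a≢b
  noRainbow (inj₂ _) _ (inj₂ _) a≢b b≢c a≢c _ _ _ _ refl refl = contradiction refl a≢c
  noRainbow _ (inj₂ _) (inj₂ _) a≢b b≢c a≢c _ _ refl refl _ _ = contradiction refl b≢c
  noRainbow (inj₂ _) (inj₁ _) (inj₁ _) a≢b b≢c a≢c refl refl refl refl refl refl = inj₂ (inj₂ (refl , refl))
  noRainbow (inj₁ _) (inj₂ _) (inj₁ _) a≢b b≢c a≢c refl refl refl refl refl refl = inj₁ (refl , refl)
  noRainbow (inj₁ _) (inj₁ _) (inj₂ _) a≢b b≢c a≢c refl refl refl refl refl refl = inj₂ (inj₁ (refl , refl))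

  lies : ∀ {i r} v → v ∈ block i r → Lies i r (from v)
  lies {i} {r} v v∈ = ∈-block⁻ (from v) (subst (_∈ block i r) (sym (strictlyInverseˡ v)) v∈)

  from-≢ : ∀ {v w} → v ≢ w → from v ≢ from w
  from-≢ v≢w e = v≢w (trans (sym (strictlyInverseˡ _)) (trans (cong to e) (strictlyInverseˡ _)))

  Block : Subset n → Set
  Block t = ∃[ i ] ∃[ r ] t ≡ block i r

  blocks-noRainbow : ∀ {T} → (∀ {t} → t ∈ₗ T → Block t) → ¬ RainbowTriangle T
  blocks-noRainbow isBlock rainbow with isBlock t₁∈T | isBlock t₂∈T | isBlock t₃∈T
    where open RainbowTriangle rainbow
  ... | i₁ , r₁ , refl | i₂ , r₂ , refl | i₃ , r₃ , refl
    with x≢y , x∈t₁ , y∈t₁ ← RainbowTriangle.xy∈t₁ rainbow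
       | y≢z , y∈t₂ , z∈t₂ ← RainbowTriangle.yz∈t₂ rainbow
       | x≢z , x∈t₃ , z∈t₃ ← RainbowTriangle.xz∈t₃ rainbow
    with noRainbow _ _ _ (from-≢ x≢y) (from-≢ y≢z) (from-≢ x≢z) (lies _ x∈t₁) (lies _ y∈t₁)
           (lies _ y∈t₂) (lies _ z∈t₂) (lies _ x∈t₃) (lies _ z∈t₃)
  ... | inj₁ (refl , refl)        = RainbowTriangle.t₁≢t₂ rainbow refl
  ... | inj₂ (inj₁ (refl , refl)) = RainbowTriangle.t₂≢t₃ rainbow refl
  ... | inj₂ (inj₂ (refl , refl)) = RainbowTriangle.t₁≢t₃ rainbow refl

open Blocks using (block; Block)

relabel : Labelling k l n → Labelling k l n → Permutation′ n
relabel S S′ = S′ ↔-∘ ↔-sym S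

relabel-block : ∀ (S S′ : Labelling k l n) i r → image (relabel S S′) (block S i r) ≡ block S′ i r
relabel-block S S′ i r = trans (image-triangle (relabel S S′) _ _ _)
  (cong₂ (λ x q → ⁅ x ⁆ ∪ q) (moves _) (cong₂ (λ y z → ⁅ y ⁆ ∪ ⁅ z ⁆) (moves _) (moves _)))
  where
  moves : ∀ a → relabel S S′ ⟨$⟩ʳ Inverse.to S a ≡ Inverse.to S′ a
  moves a = cong (Inverse.to S′) (Inverse.strictlyInverseʳ S a)

-- Enumerations, unions and products of lists.

lookup-injective : ∀ {A : Set} {xs : List A} → Unique xs → ∀ i j → List.lookup xs i ≡ List.lookup xs j → i ≡ j
lookup-injective (_ ∷ _)    zero    zero    _ = refl
lookup-injective (x∉ ∷ _)   zero    (suc j) e = contradiction e (All.lookup x∉ (∈-lookup j))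
lookup-injective (x∉ ∷ _)   (suc i) zero    e = contradiction (sym e) (All.lookup x∉ (∈-lookup i))
lookup-injective (_ ∷ xs!)  (suc i) (suc j) e = cong suc (lookup-injective xs! i j e)

-- Filtering `allFin` is the form in which `T*` lists the vertices of `R`, so a selection can be
-- compared with it directly.
module Selection {n} {P : Pred (Fin n) 0ℓ} (P? : Decidable P) where

  selection : List (Fin n)
  selection = filter P? (allFin n)

  pick : Fin (length selection) → Fin n
  pick = List.lookup selection

  pick-satisfies : ∀ i → P (pick i)
  pick-satisfies i = proj₂ (∈-filter⁻ P? {xs = allFin n} (∈-lookup i))

  pick-injective : ∀ i j → pick i ≡ pick j → i ≡ j
  pick-injective = lookup-injective (Unique.filter⁺ P? (Unique.allFin⁺ n))

  pick-surjective : ∀ {x} → P x → ∃[ i ] pick i ≡ x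
  pick-surjective {x} px = Any.index x∈ , sym (lookup-index x∈)
    where
    x∈ : x ∈ₗ selection
    x∈ = ∈-filter⁺ P? (∈-allFin x) px

  length-selection : length selection ≡ ∑[ x < n ] 𝟙 (does (P? x))
  length-selection = length-filter-tabulate id
    where
    -- The tail of `allFin` is a tabulation of `suc`, so the induction has to run over all tabulated
    -- functions.
    length-filter-tabulate : ∀ {m} (f : Fin m → Fin n) →
      length (filter P? (List.tabulate f)) ≡ ∑[ i < m ] 𝟙 (does (P? (f i)))
    length-filter-tabulate {zero}  f = refl
    length-filter-tabulate {suc m} f with does (P? (f zero))
    ... | true  = cong suc (length-filter-tabulate (f ∘ suc))
    ... | false = length-filter-tabulate (f ∘ suc)

x∈⋃⁻ : ∀ {x : Fin n} ps → x ∈ ⋃ ps → ∃[ p ] p ∈ₗ ps × x ∈ p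
x∈⋃⁻ []       x∈ = contradiction x∈ ∉⊥
x∈⋃⁻ (p ∷ ps) x∈ with x∈p∪q⁻ p (⋃ ps) x∈
... | inj₁ x∈p = p , here refl , x∈p
... | inj₂ x∈ps with x∈⋃⁻ ps x∈ps
...   | q , q∈ps , x∈q = q , there q∈ps , x∈q

x∈⋃⁺ : ∀ {x : Fin n} {p ps} → p ∈ₗ ps → x ∈ p → x ∈ ⋃ ps
x∈⋃⁺ (here refl)  x∈p = x∈p∪q⁺ (inj₁ x∈p)
x∈⋃⁺ (there p∈ps) x∈p = x∈p∪q⁺ (inj₂ (x∈⋃⁺ p∈ps x∈p))

length-cartesianProductWith : ∀ {A B C : Set} (f : A → B → C) xs ys →
  length (cartesianProductWith f xs ys) ≡ length xs * length ys
length-cartesianProductWith f []       ys = refl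
length-cartesianProductWith f (x ∷ xs) ys = trans (List.length-++ (map (f x) ys))
  (cong₂ _+_ (List.length-map (f x) ys) (length-cartesianProductWith f xs ys))

cartesianProductWith-map : ∀ {A B B′ C : Set} (f : A → B′ → C) (g : B → B′) xs ys →
  cartesianProductWith f xs (map g ys) ≡ cartesianProductWith (λ x → f x ∘ g) xs ys
cartesianProductWith-map f g []       ys = refl
cartesianProductWith-map f g (x ∷ xs) ys =
  cong₂ List._++_ (sym (List.map-∘ ys)) (cartesianProductWith-map f g xs ys)

-- The family `T*` of a pairing as a family of blocks.

module PairingFamily {n} (P : Pairing n) where
  open Pairing P
  open Selection (_∈? R)

  vertex : Fin (n / 4) × Fin 2 ⊎ Fin (length selection) → Fin n
  vertex (inj₁ (i , 0F)) = u i
  vertex (inj₁ (i , 1F)) = w i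
  vertex (inj₂ r)        = pick r

  end∈pair : ∀ i s → vertex (inj₁ (i , s)) ∈ pair i
  end∈pair i 0F = x∈p∪q⁺ (inj₁ (x∈⁅x⁆ (u i)))
  end∈pair i 1F = x∈p∪q⁺ (inj₂ (x∈⁅x⁆ (w i)))

  ∈pair⁻ : ∀ {x i} → x ∈ pair i → ∃[ s ] vertex (inj₁ (i , s)) ≡ x
  ∈pair⁻ {i = i} x∈ with x∈p∪q⁻ ⁅ u i ⁆ _ x∈
  ... | inj₁ x∈u = 0F , sym (x∈⁅y⁆⇒x≡y (u i) x∈u)
  ... | inj₂ x∈w = 1F , sym (x∈⁅y⁆⇒x≡y (w i) x∈w)

  ∈pairs : ∀ {x i} → x ∈ pair i → x ∈ ⋃ (map pair (allFin (n / 4)))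
  ∈pairs {i = i} = x∈⋃⁺ {ps = map pair (allFin (n / 4))} (∈-map⁺ pair (∈-allFin i))

  single≢end : ∀ r i s → pick r ≢ vertex (inj₁ (i , s))
  single≢end r i s e = x∈∁p⇒x∉p (pick-satisfies r) (∈pairs (subst (_∈ pair i) (sym e) (end∈pair i s)))

  vertex-injective : ∀ a b → vertex a ≡ vertex b → a ≡ b
  vertex-injective (inj₁ (i , s)) (inj₁ (j , t)) e with i ≟ j
  ... | no i≢j = contradiction
    (_ , x∈p∩q⁺ (end∈pair i s , subst (_∈ pair j) (sym e) (end∈pair j t))) (disjoint i≢j)
  ... | yes refl = cong (λ s → inj₁ (i , s)) (same s t e)
    where
    same : ∀ s t → vertex (inj₁ (i , s)) ≡ vertex (inj₁ (i , t)) → s ≡ t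
    same 0F 0F e = refl
    same 0F 1F e = contradiction e (u≢w i)
    same 1F 0F e = contradiction (sym e) (u≢w i)
    same 1F 1F e = refl
  vertex-injective (inj₁ (i , s)) (inj₂ r)       e = contradiction (sym e) (single≢end r i s)
  vertex-injective (inj₂ r)       (inj₁ (i , s)) e = contradiction e (single≢end r i s)
  vertex-injective (inj₂ q)       (inj₂ r)       e = cong inj₂ (pick-injective q r e)

  vertex-surjective : ∀ x → ∃[ a ] vertex a ≡ x
  vertex-surjective x with x ∈? ⋃ (map pair (allFin (n / 4)))
  ... | no x∉ with r , e ← pick-surjective (x∉p⇒x∈∁p x∉) = inj₂ r , e
  ... | yes x∈ with x∈⋃⁻ (map pair (allFin (n / 4))) x∈
  ...   | _ , p∈ , x∈p with ∈-map⁻ pair p∈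
  ...     | i , _ , refl with ∈pair⁻ x∈p
  ...       | s , e = inj₁ (i , s) , e

  labelling : Labelling (n / 4) (length selection) n
  labelling = injective∧surjective⇒↔ vertex-injective vertex-surjective

  ∈T*⁻ : ∀ {t} → t ∈ₗ T* P → Block labelling t
  ∈T*⁻ t∈ with ∈-cartesianProductWith⁻ _ (allFin (n / 4)) selection t∈
  ... | i , x , _ , x∈ , refl = i , Any.index x∈ , cong (triangle (u i) (w i)) (lookup-index x∈)

  ∈T*⁺ : ∀ {t} → Block labelling t → t ∈ₗ T* P
  ∈T*⁺ (i , r , refl) = ∈-cartesianProductWith⁺ (λ i r → ⁅ u i ⁆ ∪ ⁅ w i ⁆ ∪ ⁅ r ⁆) (∈-allFin i) (∈-lookup {xs = selection} r)

  -- The size is left in terms of the number of vertices in `R`; divisibility by 4 turns it into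
  -- n²/8 at the end.
  T*-isTriangleSet : IsTriangleSet (n / 4 * length selection) (T* P)
  T*-isTriangleSet = record
    { triangles = All.tabulate (λ t∈ → isTriangle (∈T*⁻ t∈))
    -- `block` is injective in the index of the single, so distinctness is shown for the product
    -- over indices and carried over to `T*`.
    ; distinct = subst Unique T*≡ (Unique.cartesianProductWith⁺ (block labelling) (Blocks.block-injective labelling)
                   (Unique.allFin⁺ _) (Unique.allFin⁺ _))
    ; size = trans (length-cartesianProductWith _ (allFin (n / 4)) selection)
               (cong (_* length selection) (List.length-tabulate {n = n / 4} id))
    }
    where
    isTriangle : ∀ {t} → Block labelling t → IsTriangle t
    isTriangle (i , r , refl) = Blocks.block-isTriangle labelling i r

    T*≡ : cartesianProductWith (block labelling) (allFin (n / 4)) (allFin (length selection)) ≡ T* P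
    T*≡ = trans (sym (cartesianProductWith-map (λ i → triangle (u i) (w i)) pick (allFin (n / 4)) (allFin _)))
      (cong (cartesianProductWith _ (allFin (n / 4)))
        (trans (List.map-tabulate id pick) (List.tabulate-lookup selection)))

  T*-noRainbow : ¬ RainbowTriangle (T* P)
  T*-noRainbow = Blocks.blocks-noRainbow labelling ∈T*⁻

-- Counting the cells hit by an injection.

does-true⇒ : ∀ {A : Set} (a? : Dec A) → does a? ≡ true → A
does-true⇒ (yes a) _ = a

sum-𝟙≤𝟙 : ∀ {m} (p : Fin m → Bool) q → (∀ i → p i ≡ true → q ≡ true) →
  (∀ i j → p i ≡ true → p j ≡ true → i ≡ j) → ∑[ i < m ] 𝟙 (p i) ≤ 𝟙 q
sum-𝟙≤𝟙 {zero}  p q p⇒q p! = z≤n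
sum-𝟙≤𝟙 {suc m} p q p⇒q p! with p zero in p₀
... | false = sum-𝟙≤𝟙 (p ∘ suc) q (p⇒q ∘ suc) (λ i j pi pj → Fin.suc-injective (p! (suc i) (suc j) pi pj))
-- After the first hit nothing else may hit, so the rest is bounded with `false` in place of `q`.
... | true rewrite p⇒q zero p₀ = s≤s (sum-𝟙≤𝟙 (p ∘ suc) false
  (λ i pi → contradiction (p! zero (suc i) p₀ pi) λ ()) (λ i j pi _ → contradiction (p! zero (suc i) p₀ pi) λ ()))

-- Double counting of the incidences `f i` = (x , y): every `i` has one, and a cell has at most one,
-- and none if `E` fails there.
injection⇒≤∑∑ : ∀ {m n} (E : Fin n → Fin n → Bool) (f : Fin m → Fin n × Fin n) →
  (∀ i j → f i ≡ f j → i ≡ j) → (∀ i → E (proj₁ (f i)) (proj₂ (f i)) ≡ true) →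
  m ≤ ∑[ x < n ] ∑[ y < n ] 𝟙 (E x y)
injection⇒≤∑∑ {m} {n} E f f-injective f∈E = begin
  m                                           ≡⟨ sum-one m ⟨
  ∑[ i < m ] 1                                ≤⟨ sum-mono hit ⟩
  ∑[ i < m ] ∑[ x < n ] ∑[ y < n ] δ i x y    ≡⟨ ∑-comm (λ i x → ∑[ y < n ] δ i x y) ⟩
  ∑[ x < n ] ∑[ i < m ] ∑[ y < n ] δ i x y    ≡⟨ sum-cong-≗ (λ x → ∑-comm (λ i y → δ i x y)) ⟩
  ∑[ x < n ] ∑[ y < n ] ∑[ i < m ] δ i x y    ≤⟨ sum-mono (λ x → sum-mono (fibre x)) ⟩
  ∑[ x < n ] ∑[ y < n ] 𝟙 (E x y)             ∎
  where
  open ≤-Reasoning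

  at? : ∀ i x y → Dec (f i ≡ (x , y))
  at? i x y = ≡-dec _≟_ _≟_ (f i) (x , y)

  δ : Fin m → Fin n → Fin n → ℕ
  δ i x y = 𝟙 (does (at? i x y))

  hit : ∀ i → 1 ≤ ∑[ x < n ] ∑[ y < n ] δ i x y
  hit i = ≤-trans (≤-reflexive (sym (cong 𝟙 (dec-true (at? i (proj₁ (f i)) (proj₂ (f i))) refl))))
    (≤-trans (term≤sum (δ i (proj₁ (f i))) (proj₂ (f i))) (term≤sum (λ x → ∑[ y < n ] δ i x y) (proj₁ (f i))))

  fibre : ∀ x y → ∑[ i < m ] δ i x y ≤ 𝟙 (E x y)
  fibre x y = sum-𝟙≤𝟙 (λ i → does (at? i x y)) (E x y)
    (λ i e → subst (λ xy → E (proj₁ xy) (proj₂ xy) ≡ true) (does-true⇒ (at? i x y) e) (f∈E i))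
    (λ i j ei ej → f-injective i j (trans (does-true⇒ (at? i x y) ei) (sym (does-true⇒ (at? j x y) ej))))

-- Choosing a cherry in every triangle of a rainbow-free family.

module Extremal {n m} (τ : Fin m → Subset n)
  (τ-isTriangle : ∀ i → IsTriangle (τ i))
  (τ-injective : ∀ i j → τ i ≡ τ j → i ≡ j)
  (noRainbow : ∀ {i j l x y z} → i ≢ j → j ≢ l → i ≢ l →
    HasEdge (τ i) x y → HasEdge (τ j) y z → HasEdge (τ l) x z → ⊥)
  where

  τ-⊆⇒≡ : ∀ i j → τ i ⊆ τ j → i ≡ j
  τ-⊆⇒≡ i j τi⊆τj = τ-injective i j (⊆∧∣∣≡⇒≡ τi⊆τj (trans (τ-isTriangle i) (sym (τ-isTriangle j))))

  Only : Fin m → Fin n → Fin n → Set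
  Only i x y = ∀ j → x ∈ τ j → y ∈ τ j → j ≡ i

  Shared : Fin m → Fin n → Fin n → Set
  Shared i x y = ∃[ j ] j ≢ i × x ∈ τ j × y ∈ τ j

  only-sym : ∀ {i x y} → Only i x y → Only i y x
  only-sym only j y∈ x∈ = only j x∈ y∈

  only⊎shared : ∀ i x y → Only i x y ⊎ Shared i x y
  only⊎shared i x y with any? (λ j → ¬? (j ≟ i) ×-dec x ∈? τ j ×-dec y ∈? τ j)
  ... | yes shared = inj₂ shared
  ... | no ¬shared = inj₁ λ j x∈ y∈ → decidable-stable (j ≟ i) (λ j≢i → ¬shared (j , j≢i , x∈ , y∈))

  -- The leaves are indexed by `Fin 2` so that the two kept edges can be treated alike.
  record Cherry (i : Fin m) : Set where
    field
      centre         : Fin n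
      leaf           : Fin 2 → Fin n
      leaf₀≢leaf₁    : leaf 0F ≢ leaf 1F
      leaf≢centre    : ∀ s → leaf s ≢ centre
      τ≡triangle     : τ i ≡ triangle (leaf 0F) (leaf 1F) centre
      only           : ∀ s → Only i centre (leaf s)

  -- Two shared edges, together with the triangle itself on the third edge, would be rainbow.
  ¬shared² : ∀ {i x y z} → x ≢ y → x ≢ z → y ≢ z → τ i ≡ triangle x y z → Shared i x y → Shared i y z → ⊥
  ¬shared² {i} {x} {y} {z} x≢y x≢z y≢z τ≡ (j , j≢i , x∈j , y∈j) (l , l≢i , y∈l , z∈l) =
    noRainbow j≢l l≢i j≢i (x≢y , x∈j , y∈j) (y≢z , y∈l , z∈l)
      (x≢z , subst (x ∈_) (sym τ≡) (∈-triangle₁ x y z) , subst (z ∈_) (sym τ≡) (∈-triangle₃ x y z))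
    where
    j≢l : j ≢ l
    j≢l refl = j≢i (sym (τ-⊆⇒≡ i j (subst (_⊆ τ j) (sym τ≡) (triangle-⊆ x∈j y∈j z∈l))))

  vertices⇒τ≡triangle : ∀ {i a b c} → a ≢ b → a ≢ c → b ≢ c → a ∈ τ i → b ∈ τ i → c ∈ τ i → τ i ≡ triangle a b c
  vertices⇒τ≡triangle {i} a≢b a≢c b≢c a∈ b∈ c∈ =
    sym (⊆∧∣∣≡⇒≡ (triangle-⊆ a∈ b∈ c∈) (trans (∣triangle∣ a≢b a≢c b≢c) (sym (τ-isTriangle i))))

  mkCherry : ∀ {i} c a b → a ≢ b → a ≢ c → b ≢ c → a ∈ τ i → b ∈ τ i → c ∈ τ i →
    Only i c a → Only i c b → Cherry i
  mkCherry {i} c a b a≢b a≢c b≢c a∈ b∈ c∈ ca cb = record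
    { centre = c
    ; leaf = λ { 0F → a ; 1F → b }
    ; leaf₀≢leaf₁ = a≢b
    ; leaf≢centre = λ { 0F → a≢c ; 1F → b≢c }
    ; τ≡triangle = vertices⇒τ≡triangle a≢b a≢c b≢c a∈ b∈ c∈
    ; only = λ { 0F → ca ; 1F → cb }
    }

  -- By `¬shared²`, applied with each vertex in the middle, at most one edge is shared. Two unshared
  -- edges remain, and their common end is the centre.
  chooseCherry : ∀ i → Cherry i
  chooseCherry i with isTriangle⇒triangle (τ-isTriangle i)
  ... | x , y , z , x≢y , x≢z , y≢z , τ≡ = choose (only⊎shared i x y) (only⊎shared i y z) (only⊎shared i x z)
    where
    x∈ : x ∈ τ i
    x∈ = subst (x ∈_) (sym τ≡) (∈-triangle₁ x y z)
    y∈ : y ∈ τ i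
    y∈ = subst (y ∈_) (sym τ≡) (∈-triangle₂ x y z)
    z∈ : z ∈ τ i
    z∈ = subst (z ∈_) (sym τ≡) (∈-triangle₃ x y z)

    flip : ∀ {x y} → Shared i x y → Shared i y x
    flip (j , j≢i , x∈j , y∈j) = j , j≢i , y∈j , x∈j

    choose : Only i x y ⊎ Shared i x y → Only i y z ⊎ Shared i y z → Only i x z ⊎ Shared i x z → Cherry i
    choose (inj₁ xy) (inj₁ yz) _ = mkCherry y x z x≢z x≢y (y≢z ∘ sym) x∈ z∈ y∈ (only-sym {i} xy) yz
    choose (inj₁ xy) _ (inj₁ xz) = mkCherry x y z y≢z (x≢y ∘ sym) (x≢z ∘ sym) y∈ z∈ x∈ xy xz
    choose _ (inj₁ yz) (inj₁ xz) = mkCherry z x y x≢y x≢z y≢z x∈ y∈ z∈ (only-sym {i} xz) (only-sym {i} yz)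
    choose (inj₂ xy) (inj₂ yz) _ = ⊥-elim (¬shared² x≢y x≢z y≢z τ≡ xy yz)
    choose (inj₂ xy) _ (inj₂ xz) = ⊥-elim (¬shared² (x≢y ∘ sym) y≢z x≢z
      (vertices⇒τ≡triangle (x≢y ∘ sym) y≢z x≢z y∈ x∈ z∈) (flip xy) xz)
    choose _ (inj₂ yz) (inj₂ xz) = ⊥-elim (¬shared² x≢z x≢y (y≢z ∘ sym)
      (vertices⇒τ≡triangle x≢z x≢y (y≢z ∘ sym) x∈ z∈ y∈) xz (flip yz))

  -- The graph of kept edges.

  module Chosen (cherry : ∀ i → Cherry i) where

    module _ (i : Fin m) where
      open Cherry (cherry i) public

    centre∈ : ∀ i → centre i ∈ τ i
    centre∈ i = subst (centre i ∈_) (sym (τ≡triangle i)) (∈-triangle₃ (leaf i 0F) (leaf i 1F) _)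

    leaf∈ : ∀ i s → leaf i s ∈ τ i
    leaf∈ i 0F = subst (leaf i 0F ∈_) (sym (τ≡triangle i)) (∈-triangle₁ _ _ _)
    leaf∈ i 1F = subst (leaf i 1F ∈_) (sym (τ≡triangle i)) (∈-triangle₂ (leaf i 0F) _ _)

    leaf-injective : ∀ i s t → leaf i s ≡ leaf i t → s ≡ t
    leaf-injective i 0F 0F e = refl
    leaf-injective i 0F 1F e = contradiction e (leaf₀≢leaf₁ i)
    leaf-injective i 1F 0F e = contradiction (sym e) (leaf₀≢leaf₁ i)
    leaf-injective i 1F 1F e = refl

    Kept : Fin m → Fin n → Fin n → Set
    Kept i x y = ∃[ s ] ((x ≡ centre i × y ≡ leaf i s) ⊎ (x ≡ leaf i s × y ≡ centre i))

    Edge : Fin n → Fin n → Set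
    Edge x y = ∃[ i ] Kept i x y

    edge? : ∀ x y → Dec (Edge x y)
    edge? x y = any? λ i → any? λ s →
      ((x ≟ centre i) ×-dec (y ≟ leaf i s)) ⊎-dec ((x ≟ leaf i s) ×-dec (y ≟ centre i))

    kept-only : ∀ {i x y} → Kept i x y → Only i x y
    kept-only {i} (s , inj₁ (refl , refl)) = only i s
    kept-only {i} (s , inj₂ (refl , refl)) = only-sym {i} (only i s)

    kept-edge : ∀ {i x y} → Kept i x y → HasEdge (τ i) x y
    kept-edge {i} (s , inj₁ (refl , refl)) = leaf≢centre i s ∘ sym , centre∈ i , leaf∈ i s
    kept-edge {i} (s , inj₂ (refl , refl)) = leaf≢centre i s , leaf∈ i s , centre∈ i

    edge-sym : ∀ {x y} → Edge x y → Edge y x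
    edge-sym (i , s , inj₁ (x≡ , y≡)) = i , s , inj₂ (y≡ , x≡)
    edge-sym (i , s , inj₂ (x≡ , y≡)) = i , s , inj₁ (y≡ , x≡)

    kept-end : ∀ {i x y} → Kept i x y → (x ≡ centre i × y ≢ centre i) ⊎ (x ≢ centre i × y ≡ centre i)
    kept-end {i} (s , inj₁ (refl , refl)) = inj₁ (refl , leaf≢centre i s)
    kept-end {i} (s , inj₂ (refl , refl)) = inj₂ (leaf≢centre i s , refl)

    -- Each kept edge of `i` has exactly one end at the centre, so being the centre would have to
    -- alternate around a cycle of length three.
    ¬kept³ : ∀ {i x y z} → Kept i x y → Kept i y z → Kept i x z → ⊥
    ¬kept³ xy yz xz with kept-end xy | kept-end yz | kept-end xz
    ... | inj₁ (x≡ , y≢) | inj₁ (y≡ , _)  | _              = y≢ y≡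
    ... | inj₁ (x≡ , y≢) | inj₂ (_  , z≡) | inj₁ (_  , z≢) = z≢ z≡
    ... | inj₁ (x≡ , y≢) | inj₂ _         | inj₂ (x≢ , _)  = x≢ x≡
    ... | inj₂ (x≢ , y≡) | inj₂ (y≢ , _)  | _              = y≢ y≡
    ... | inj₂ (x≢ , y≡) | inj₁ (_  , z≢) | inj₂ (_  , z≡) = z≢ z≡
    ... | inj₂ (x≢ , y≡) | inj₁ _         | inj₁ (x≡ , _)  = x≢ x≡

    -- If two of the edges come from the same triangle of the family, it contains x, y and z. The
    -- third edge is kept, so it comes from that triangle too, against `¬kept³`. Otherwise the three
    -- triangles are rainbow.
    edge-triangle-free : ∀ {x y z} → Edge x y → Edge y z → Edge x z → ⊥
    edge-triangle-free (i , xy) (j , yz) (l , xz)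
      with x≢y , x∈i , y∈i ← kept-edge xy | y≢z , y∈j , z∈j ← kept-edge yz | x≢z , x∈l , z∈l ← kept-edge xz
      with i ≟ j | j ≟ l | i ≟ l
    ... | yes refl | _        | _ with refl ← kept-only xz i x∈i z∈j = ¬kept³ xy yz xz
    ... | _        | yes refl | _ with refl ← kept-only xy j x∈l y∈j = ¬kept³ xy yz xz
    ... | _        | _        | yes refl with refl ← kept-only yz i y∈i z∈l = ¬kept³ xy yz xz
    ... | no i≢j   | no j≢l   | no i≢l = noRainbow i≢j j≢l i≢l
      (kept-edge xy) (kept-edge yz) (kept-edge xz)

    adjacent : Fin n → Fin n → Bool
    adjacent x y = does (edge? x y)

    adjacent-sym : ∀ x y → adjacent x y ≡ adjacent y x
    adjacent-sym x y with edge? x y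
    ... | yes e = sym (dec-true (edge? y x) (edge-sym e))
    ... | no ¬e = sym (dec-false (edge? y x) (¬e ∘ edge-sym))

    -- The last index is the orientation: the degree sum counts ordered pairs, so each cherry
    -- contributes four.
    arc : (Fin m × Fin 2) × Fin 2 → Fin n × Fin n
    arc ((i , s) , 0F) = centre i , leaf i s
    arc ((i , s) , 1F) = leaf i s , centre i

    -- A kept edge determines its triangle by `only`; within one cherry the leaf and the orientation
    -- are then determined, since no leaf is the centre.
    arc-injective : ∀ a b → arc a ≡ arc b → a ≡ b
    arc-injective ((i , s) , 0F) ((j , t) , 0F) e with c≡ , l≡ ← ,-injective e
      with refl ← only j t i (subst (_∈ τ i) c≡ (centre∈ i)) (subst (_∈ τ i) l≡ (leaf∈ i s))
      with refl ← leaf-injective i s t l≡ = refl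
    arc-injective ((i , s) , 1F) ((j , t) , 1F) e with l≡ , c≡ ← ,-injective e
      with refl ← only j t i (subst (_∈ τ i) c≡ (centre∈ i)) (subst (_∈ τ i) l≡ (leaf∈ i s))
      with refl ← leaf-injective i s t l≡ = refl
    arc-injective ((i , s) , 0F) ((j , t) , 1F) e with c≡ , l≡ ← ,-injective e
      with refl ← only j t i (subst (_∈ τ i) l≡ (leaf∈ i s)) (subst (_∈ τ i) c≡ (centre∈ i)) =
      contradiction (sym c≡) (leaf≢centre i t)
    arc-injective ((i , s) , 1F) ((j , t) , 0F) e with l≡ , c≡ ← ,-injective e
      with refl ← only j t i (subst (_∈ τ i) l≡ (leaf∈ i s)) (subst (_∈ τ i) c≡ (centre∈ i)) =
      contradiction l≡ (leaf≢centre i s)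

    arc-adjacent : ∀ a → adjacent (proj₁ (arc a)) (proj₂ (arc a)) ≡ true
    arc-adjacent ((i , s) , 0F) = dec-true (edge? _ _) (i , s , inj₁ (refl , refl))
    arc-adjacent ((i , s) , 1F) = dec-true (edge? _ _) (i , s , inj₂ (refl , refl))

    arcs : m * 2 * 2 ≤ ∑[ x < n ] ∑[ y < n ] 𝟙 (adjacent x y)
    arcs = injection⇒≤∑∑ adjacent (arc ∘ to) (λ a b e → to-injective (arc-injective (to a) (to b) e)) (arc-adjacent ∘ to)
      where
      index : Fin (m * 2 * 2) ↔ ((Fin m × Fin 2) × Fin 2)
      index = (*↔× ×-↔ ↔-id _) ↔-∘ *↔×
      open Injection (↔⇒↣ index) using (to) renaming (injective to to-injective)

    -- The 4m arcs bound the degree sum from below, and twice 4m is n², which is the density that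
    -- the equality case of Mantel asks for.
    bipartition : n * n ≡ 8 * m → Fin m →
      ∃[ side ] (∀ {x y} → Edge x y → side x ≢ side y) × (∀ {x y} → side x ≢ side y → Edge x y) ×
        ∑[ x < n ] 𝟙 (side x) ≡ ∑[ x < n ] 𝟙 (not (side x))
    bipartition n²≡8m i₀ = fromMantel (Mantel.completeBipartite adjacent adjacent-sym
      (λ x y z xy yz xz → edge-triangle-free
        (does-true⇒ (edge? x y) xy) (does-true⇒ (edge? y z) yz) (does-true⇒ (edge? x z) xz))
      -- Any vertex serves here; it is the starting value of the search for a maximal degree.
      (centre i₀) dense)
      where
      8m≡2*arcs : 8 * m ≡ 2 * (m * 2 * 2)
      8m≡2*arcs = solve 1 (λ m → con 8 :* m := con 2 :* (m :* con 2 :* con 2)) refl m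
        where open +-*-Solver

      dense : n * n ≤ 2 * ∑[ x < n ] ∑[ y < n ] 𝟙 (adjacent x y)
      dense = ≤-trans (≤-reflexive (trans n²≡8m 8m≡2*arcs)) (*-monoʳ-≤ 2 arcs)

      ≢⇒xor : ∀ {a b} → a ≢ b → a xor b ≡ true
      ≢⇒xor {false} {false} a≢b = contradiction refl a≢b
      ≢⇒xor {false} {true}  _   = refl
      ≢⇒xor {true}  {false} _   = refl
      ≢⇒xor {true}  {true}  a≢b = contradiction refl a≢b

      fromMantel : ∃[ side ] (∀ x y → adjacent x y ≡ side x xor side y) ×
        ∑[ x < n ] 𝟙 (side x) ≡ ∑[ x < n ] 𝟙 (not (side x)) → _
      fromMantel (side , adjacent≡ , balanced) = side ,
        (λ {x} {y} e s≡ → contradiction (trans (sym (dec-true (edge? x y) e))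
          (trans (adjacent≡ x y) (trans (cong (side x xor_) (sym s≡)) (xor-same (side x))))) λ ()) ,
        (λ {x} {y} s≢ → does-true⇒ (edge? x y) (trans (adjacent≡ x y) (≢⇒xor s≢))) ,
        balanced

    -- Recovering the pairs and the single vertices from the bipartition.

    module Bipartition (side : Fin n → Bool) (edge⇒≢ : ∀ {x y} → Edge x y → side x ≢ side y)
      (≢⇒edge : ∀ {x y} → side x ≢ side y → Edge x y)
      (balanced : ∑[ x < n ] 𝟙 (side x) ≡ ∑[ x < n ] 𝟙 (not (side x))) (i₀ : Fin m) where

      side-leaf : ∀ i s → side (leaf i s) ≢ side (centre i)
      side-leaf i s = edge⇒≢ (i , s , inj₂ (refl , refl))

      -- A leaf has just one kept edge in its cherry, so a vertex with two of them is the centre.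
      kept-centre : ∀ {i x y z} → Kept i x y → Kept i x z → y ≢ z → centre i ≡ x
      kept-centre (_ , inj₁ (x≡ , _)) _                  _   = sym x≡
      kept-centre (_ , inj₂ _)        (_ , inj₁ (x≡ , _)) _  = sym x≡
      kept-centre (_ , inj₂ (_ , y≡)) (_ , inj₂ (_ , z≡)) y≢z = contradiction (trans y≡ (sym z≡)) y≢z

      -- The edges from d to the two leaves lie in one triangle, for otherwise
      -- their triangles and τ i would be rainbow.
      recentre : ∀ i d → side d ≡ side (centre i) →
        ∃[ j ] centre j ≡ d × τ j ≡ triangle (leaf i 0F) (leaf i 1F) d
      recentre i d s≡ with ≢⇒edge (side-d≢ 0F) | ≢⇒edge (side-d≢ 1F)
        where
        side-d≢ : ∀ s → side d ≢ side (leaf i s)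
        side-d≢ s e = side-leaf i s (trans (sym e) s≡)
      ... | j , dl₀ | l , dl₁ with d≢l₀ , d∈j , l₀∈j ← kept-edge dl₀ | d≢l₁ , d∈l , l₁∈l ← kept-edge dl₁ with j ≟ l
      ...   | yes refl = j , kept-centre dl₀ dl₁ (leaf₀≢leaf₁ i) ,
        vertices⇒τ≡triangle (leaf₀≢leaf₁ i) (d≢l₀ ∘ sym) (d≢l₁ ∘ sym) l₀∈j l₁∈l d∈j
      ...   | no j≢l with d ≟ centre i
      ...     | yes refl = contradiction (trans (sym (kept-only dl₀ i (centre∈ i) (leaf∈ i 0F)))
                             (kept-only dl₁ i (centre∈ i) (leaf∈ i 1F))) j≢l
      ...     | no d≢c = ⊥-elim (noRainbow (λ { refl → d∉ d∈j }) (λ { refl → d∉ d∈l }) j≢l (d≢l₀ , d∈j , l₀∈j)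
                  (leaf₀≢leaf₁ i , leaf∈ i 0F , leaf∈ i 1F) (d≢l₁ , d∈l , l₁∈l))
        where
        d∉ : ¬ d ∈ τ i
        d∉ d∈ with ∈-triangle⁻ (subst (d ∈_) (τ≡triangle i) d∈)
        ... | inj₁ d≡        = d≢l₀ d≡
        ... | inj₂ (inj₁ d≡) = d≢l₁ d≡
        ... | inj₂ (inj₂ d≡) = d≢c d≡

      ≢∧≢⇒≡ : ∀ {a b c : Bool} → a ≢ b → c ≢ b → a ≡ c
      ≢∧≢⇒≡ a≢b c≢b = trans (¬-not a≢b) (sym (¬-not c≢b))

      -- Were the centres i and j on opposite sides, an edge joining a leaf of i
      -- to a leaf of j would lie in two cherries, centred at either end.
      centres-aligned : ∀ i j → side (centre i) ≡ side (centre j)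
      centres-aligned i j with side (centre i) Bool.≟ side (centre j)
      ... | yes s≡ = s≡
      ... | no  s≢ with recentre i (leaf j 0F) (≢∧≢⇒≡ (side-leaf j 0F) s≢)
                      | recentre j (leaf i 0F) (≢∧≢⇒≡ (side-leaf i 0F) (s≢ ∘ sym))
      ...   | j′ , c≡y , τ≡y | i′ , c≡x , τ≡x = contradiction (cong side (trans (sym c≡x) (trans (cong centre i′≡j′) c≡y))) x≢y
        where
        x≢y : side (leaf i 0F) ≢ side (leaf j 0F)
        x≢y e = s≢ (≢∧≢⇒≡ {b = side (leaf i 0F)} (side-leaf i 0F ∘ sym) (λ c≡ → side-leaf j 0F (sym (trans c≡ e))))

        i′≡j′ : i′ ≡ j′
        i′≡j′ with k , xy ← ≢⇒edge x≢y = trans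
          (kept-only xy i′ (subst (leaf i 0F ∈_) (sym τ≡x) (∈-triangle₃ (leaf j 0F) (leaf j 1F) _))
                           (subst (leaf j 0F ∈_) (sym τ≡x) (∈-triangle₁ _ _ _)))
          (sym (kept-only xy j′ (subst (leaf i 0F ∈_) (sym τ≡y) (∈-triangle₁ _ _ _))
                                (subst (leaf j 0F ∈_) (sym τ≡y) (∈-triangle₃ (leaf i 0F) (leaf i 1F) _))))

      -- The vertices off the side of the centres are joined to the hub by kept
      -- edges, so they are the leaves of the cherries centred at the hub.
      hub : Fin n
      hub = centre i₀

      module Hubbed = Selection (λ j → centre j ≟ hub)
      module Same = Selection (λ x → side x Bool.≟ side hub)

      vertex : Fin (length Hubbed.selection) × Fin 2 ⊎ Fin (length Same.selection) → Fin n
      vertex (inj₁ (a , s)) = leaf (Hubbed.pick a) s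
      vertex (inj₂ r)       = Same.pick r

      single≢end : ∀ r a s → Same.pick r ≢ leaf (Hubbed.pick a) s
      single≢end r a s e = side-leaf (Hubbed.pick a) s (trans (cong side (sym e))
        (trans (Same.pick-satisfies r) (centres-aligned _ _)))

      vertex-injective : ∀ a b → vertex a ≡ vertex b → a ≡ b
      vertex-injective (inj₁ (a , s)) (inj₁ (b , t)) e
        -- Two cherries centred at the hub with a common leaf share a kept edge, and `only`
        -- identifies them.
        with refl ← Hubbed.pick-injective a b (only (Hubbed.pick b) t (Hubbed.pick a)
          (subst (_∈ τ (Hubbed.pick a)) (trans (Hubbed.pick-satisfies a) (sym (Hubbed.pick-satisfies b))) (centre∈ (Hubbed.pick a)))
          (subst (_∈ τ (Hubbed.pick a)) e (leaf∈ (Hubbed.pick a) s)))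
        = cong (λ s → inj₁ (a , s)) (leaf-injective (Hubbed.pick a) s t e)
      vertex-injective (inj₁ (a , s)) (inj₂ r)       e = contradiction (sym e) (single≢end r a s)
      vertex-injective (inj₂ r)       (inj₁ (a , s)) e = contradiction e (single≢end r a s)
      vertex-injective (inj₂ q)       (inj₂ r)       e = cong inj₂ (Same.pick-injective q r e)

      vertex-surjective : ∀ x → ∃[ a ] vertex a ≡ x
      vertex-surjective x with side x Bool.≟ side hub
      ... | yes s≡ with r , e ← Same.pick-surjective s≡ = inj₂ r , e
      ... | no  s≢ with ≢⇒edge (s≢ ∘ sym)
      -- In this orientation `x` itself would be a centre, hence on the side of the hub.
      ...   | j , s , inj₂ (_ , refl) = contradiction (centres-aligned j i₀) s≢
      ...   | j , s , inj₁ (h≡ , refl) with a , refl ← Hubbed.pick-surjective (sym h≡) = inj₁ (a , s) , refl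

      labelling : Labelling (length Hubbed.selection) (length Same.selection) n
      labelling = injective∧surjective⇒↔ vertex-injective vertex-surjective

      half : length Same.selection + length Same.selection ≡ n
      half = trans (cong₂ _+_ Same.length-selection Same.length-selection) (halves (side hub))
        where
        as-true : ∀ b → does (b Bool.≟ true) ≡ b
        as-true false = refl
        as-true true  = refl

        as-false : ∀ b → does (b Bool.≟ false) ≡ not b
        as-false false = refl
        as-false true  = refl

        halves : ∀ b → ∑[ x < n ] 𝟙 (does (side x Bool.≟ b)) + ∑[ x < n ] 𝟙 (does (side x Bool.≟ b)) ≡ n
        halves true rewrite sum-cong-≗ (cong 𝟙 ∘ as-true ∘ side) =
          trans (cong (∑[ x < n ] 𝟙 (side x) +_) balanced) (sum-complement side)
        halves false rewrite sum-cong-≗ (cong 𝟙 ∘ as-false ∘ side) =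
          trans (cong (_+ ∑[ x < n ] 𝟙 (not (side x))) (sym balanced)) (sum-complement side)

      block∈ : ∀ a r → ∃[ i ] τ i ≡ block labelling a r
      block∈ a r with j , _ , τ≡ ← recentre (Hubbed.pick a) (Same.pick r)
                        (trans (Same.pick-satisfies r) (centres-aligned _ _)) = j , τ≡

      -- Recentre `i` at the hub, which yields a hub cherry on the same two leaves, and then
      -- recentre that cherry at `centre i`. The resulting triangle shares a kept edge with `τ i`,
      -- so it is `τ i`, and by construction it is a block.
      τ-block : ∀ i → Block labelling (τ i)
      τ-block i with recentre i hub (centres-aligned i₀ i)
      ... | j , c≡h , τ≡ with a , refl ← Hubbed.pick-surjective c≡h | r , r≡ ← Same.pick-surjective (centres-aligned i i₀)
        with recentre (Hubbed.pick a) (centre i) (centres-aligned _ _)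
      ...   | i′ , _ , τ′≡ = a , r , trans (cong τ (sym i′≡i)) (trans τ′≡ (cong (triangle _ _) (sym r≡)))
        where
        -- The hub cherry may list the two leaves in the other order, so both positions are tried;
        -- the hub itself is on the wrong side.
        l₀∈ : leaf i 0F ∈ τ i′
        l₀∈ with ∈-triangle⁻ (subst (leaf i 0F ∈_) (trans (sym τ≡) (τ≡triangle (Hubbed.pick a))) (∈-triangle₁ _ _ _))
        ... | inj₁ e rewrite e | τ′≡ = ∈-triangle₁ _ _ _
        ... | inj₂ (inj₁ e) rewrite e | τ′≡ = ∈-triangle₂ (leaf (Hubbed.pick a) 0F) _ _
        ... | inj₂ (inj₂ e) = contradiction (trans (cong side e) (centres-aligned _ _)) (side-leaf i 0F)

        i′≡i : i′ ≡ i
        i′≡i = only i 0F i′ (subst (centre i ∈_) (sym τ′≡) (∈-triangle₃ (leaf (Hubbed.pick a) 0F) (leaf (Hubbed.pick a) 1F) _)) l₀∈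

  structure : n * n ≡ 8 * m → Fin m →
    ∃[ k ] ∃[ l ] ∃[ S ] l + l ≡ n × (∀ i → Block {k} {l} S (τ i)) × (∀ a r → ∃[ i ] τ i ≡ block S a r)
  structure n²≡8m i₀ = fromBipartition (Chosen.bipartition chooseCherry n²≡8m i₀)
    where
    fromBipartition : _ → _
    fromBipartition (side , edge⇒≢ , ≢⇒edge , balanced) = _ , _ , labelling , half , τ-block , block∈
      where open Chosen.Bipartition chooseCherry side edge⇒≢ ≢⇒edge balanced i₀

-- Isomorphism of block families, the sizes, and the conclusion.

-- When the parameters agree, sending each vertex to the one with the same label carries each block
-- to the block with the same indices.
blocks-isomorphic : ∀ {k′ l′} → k ≡ k′ → l ≡ l′ → (S : Labelling k l n) (S′ : Labelling k′ l′ n) → ∀ {T T′} →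
  (∀ {t} → t ∈ₗ T → Block S t) → (∀ {t} → Block S t → t ∈ₗ T) →
  (∀ {t} → t ∈ₗ T′ → Block S′ t) → (∀ {t} → Block S′ t → t ∈ₗ T′) →
  T IsIsomorphicTo T′
blocks-isomorphic refl refl S S′ {T} {T′} T⊆ T⊇ T′⊆ T′⊇ = relabel S′ S , mk⇔ forth back
  where
  forth : ∀ {t} → t ∈ₗ T → t ∈ₗ map (image (relabel S′ S)) T′
  forth t∈ with i , r , refl ← T⊆ t∈ =
    subst (_∈ₗ _) (relabel-block S′ S i r) (∈-map⁺ (image (relabel S′ S)) (T′⊇ (i , r , refl)))

  back : ∀ {t} → t ∈ₗ map (image (relabel S′ S)) T′ → t ∈ₗ T
  back t∈ with t′ , t′∈ , refl ← ∈-map⁻ (image (relabel S′ S)) t∈ with i , r , refl ← T′⊆ t′∈ =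
    T⊇ (i , r , relabel-block S′ S i r)

n²/8≡ : ∀ q → (q * 4) ^ 2 / 8 ≡ q * (q * 2)
n²/8≡ q = trans (cong (_/ 8) expand) (m*n/n≡m (q * (q * 2)) 8)
  where
  open +-*-Solver
  expand : (q * 4) ^ 2 ≡ q * (q * 2) * 8
  expand = solve 1 (λ q → (q :* con 4) :* ((q :* con 4) :* con 1) := q :* (q :* con 2) :* con 8) refl q

n²≡8*[n²/8] : ∀ q → q * 4 * (q * 4) ≡ 8 * (q * (q * 2))
n²≡8*[n²/8] = solve 1 (λ q → q :* con 4 :* (q :* con 4) := con 8 :* (q :* (q :* con 2))) refl
  where open +-*-Solver

module _ {n} (4∣n : 4 ∣ n) (P : Pairing n) where
  open PairingFamily P

  n/4*4≡n : n / 4 * 4 ≡ n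
  n/4*4≡n = m/n*n≡m 4∣n

  size≡ : n ^ 2 / 8 ≡ n / 4 * (n / 4 * 2)
  size≡ = trans (cong (λ n → n ^ 2 / 8) (sym n/4*4≡n)) (n²/8≡ (n / 4))

  doubles : n / 4 * 2 + n / 4 * 2 ≡ n
  doubles = trans (sym (*-distribˡ-+ (n / 4) 2 2)) n/4*4≡n

  -- `R` is not counted directly: the labelling is a bijection, so the singles are what the ends of
  -- the pairs leave over.
  singles≡ : n / 4 * 2 ≡ length (Selection.selection (_∈? Pairing.R P))
  singles≡ = +-cancelˡ-≡ (n / 4 * 2) _ _ (trans doubles (sym (labelling-size labelling)))

  isIsomorphicToT* : .{{NonZero n}} → ∀ T → IsTriangleSet (n ^ 2 / 8) T → ¬ RainbowTriangle T → T IsIsomorphicTo T* P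
  isIsomorphicToT* T isSet ¬rainbow = fromStructure (Extremal.structure (List.lookup T)
    (λ i → All.lookup triangles (∈-lookup i)) (lookup-injective distinct) noRainbow n²≡8m (first T length≡))
    where
    open IsTriangleSet isSet

    length≡ : length T ≡ n / 4 * (n / 4 * 2)
    length≡ = trans size size≡

    n²≡8m : n * n ≡ 8 * length T
    n²≡8m = trans (cong₂ _*_ (sym n/4*4≡n) (sym n/4*4≡n)) (trans (n²≡8*[n²/8] (n / 4)) (cong (8 *_) (sym length≡)))

    -- Positivity of n enters here: an empty family would force n / 4, and with it n, to be zero.
    first : ∀ T → length T ≡ n / 4 * (n / 4 * 2) → Fin (length T)
    first (_ ∷ _) _ = zero
    first []      e = contradiction (trans (sym n/4*4≡n) (cong (_* 4) n/4≡0)) (≢-nonZero⁻¹ n)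
      where
      n/4≡0 : n / 4 ≡ 0
      n/4≡0 = [ id , m*n≡0⇒m≡0 (n / 4) 2 ]′ (m*n≡0⇒m≡0∨n≡0 (n / 4) (sym e))

    noRainbow : ∀ {i j l x y z} → i ≢ j → j ≢ l → i ≢ l → HasEdge (List.lookup T i) x y →
      HasEdge (List.lookup T j) y z → HasEdge (List.lookup T l) x z → ⊥
    noRainbow i≢j j≢l i≢l xy yz xz = ¬rainbow record
      { t₁∈T = ∈-lookup _ ; t₂∈T = ∈-lookup _ ; t₃∈T = ∈-lookup _
      ; t₁≢t₂ = i≢j ∘ lookup-injective distinct _ _
      ; t₂≢t₃ = j≢l ∘ lookup-injective distinct _ _
      ; t₁≢t₃ = i≢l ∘ lookup-injective distinct _ _
      ; xy∈t₁ = xy ; yz∈t₂ = yz ; xz∈t₃ = xz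
      }

    fromStructure : ∃[ k ] ∃[ l ] ∃[ S ] l + l ≡ n × (∀ i → Block {k} {l} S (List.lookup T i)) ×
      (∀ a r → ∃[ i ] List.lookup T i ≡ block S a r) → T IsIsomorphicTo T* P
    fromStructure (k , l , S , l+l≡n , T⊆ , T⊇) = blocks-isomorphic k≡ (trans l≡ singles≡) S labelling
      (λ t∈ → subst (Block S) (sym (lookup-index t∈)) (T⊆ (Any.index t∈)))
      (λ { (a , r , refl) → subst (_∈ₗ T) (proj₂ (T⊇ a r)) (∈-lookup (proj₁ (T⊇ a r))) })
      ∈T*⁻ ∈T*⁺
      where
      l≡ : l ≡ n / 4 * 2
      l≡ = *-cancelˡ-≡ l _ 2 (trans (double l) (trans (trans l+l≡n (sym doubles)) (sym (double (n / 4 * 2)))))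
        where
        double : ∀ a → 2 * a ≡ a + a
        double a = cong (a +_) (+-identityʳ a)

      k≡ : k ≡ n / 4
      k≡ = *-cancelʳ-≡ k (n / 4) 2 (+-cancelʳ-≡ l _ _
        (trans (labelling-size S) (sym (trans (cong (n / 4 * 2 +_) l≡) doubles))))

theorem2p2 : (n : ℕ) → .{{_ : NonZero n}} → 4 ∣ n → (P : Pairing n) →
    IsTriangleSet (n ^ 2 / 8) (T* P) ×
    ¬ RainbowTriangle (T* P) ×
    ((T : List (Subset n)) → IsTriangleSet (n ^ 2 / 8) T → ¬ RainbowTriangle T →
    T IsIsomorphicTo T* P)
theorem2p2 n 4∣n P =
  subst (λ m → IsTriangleSet m (T* P))
    (sym (trans (size≡ 4∣n P) (cong (n / 4 *_) (singles≡ 4∣n P)))) T*-isTriangleSet ,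
  T*-noRainbow ,
  isIsomorphicToT* 4∣n P
  where open PairingFamily P
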